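{- Let $G=(V;E)$ be the random graph. Let $\mathscr M$ be a locally closed monoid of mappings $V\to V$ (under composition) which contains the automorphism group $\mathrm{Aut}(G)$. Then at least one of the following holds: (1) $\mathscr M$ contains a constant operation; (2) $\mathscr M$ contains $e_E$; (3) $\mathscr M$ contains $e_N$; (4) $\mathscr M$ equals the smallest locally closed monoid of maps $V\to V$ that contains all permutations of $V$ belonging to $\mathscr M$ (i.e. $\mathscr M$ is generated by the permutations it contains).
   Context: The random graph $G=(V;E)$ is the unique (up to isomorphism) countably infinite graph such that for all finite disjoint $U,U'\subseteq V$ there is $v\in V\setminus(U\cup U')$ adjacent to every vertex of $U$ and to no vertex of $U'$. A monoid $\mathscr M$ of maps $D\to D$ is locally closed if whenever $f:D\to D$ is such that for every finite $A\subseteq D$ some $e\in\mathscr M$ agrees with $f$ on $A$, then $f\in\mathscr M$ (equivalently, $\mathscr M$ is closed in the product topology on $D^D$ with $D$ discrete). $e_E$ denotes a fixed injective map $V\to V$ whose image induces an infinite complete graph in $G$, and $e_N$ a fixed injective map $V\to V$ whose image induces an infinite independent set in $G$ (any two choices of such maps generate the same locally closed monoid together with $\mathrm{Aut}(G)$). -}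

module Defs where

open import Level using (Level; 0ℓ) renaming (suc to lsuc)
open import Data.Nat using (ℕ)
open import Data.List using (List)
open import Data.List.Membership.Propositional using (_∈_)
open import Data.List.Relation.Unary.All using (All)
open import Data.List.Relation.Unary.Any using (Any)
open import Data.Product using (Σ; ∃; _×_; _,_)
open import Relation.Binary.PropositionalEquality using (_≡_; _≢_)
open import Relation.Nullary using (¬_)
open import Function using (_∘_; id)

-- Vertices are ℕ (a countably infinite set); a graph on ℕ is a relation E.
Rel₀ : Set₁
Rel₀ = ℕ → ℕ → Set

IsGraph : Rel₀ → Set
IsGraph E = (∀ x y → E x y → E y x) × (∀ x → ¬ E x x)

ExtensionProperty : Rel₀ → Set
ExtensionProperty E =
  (U U' : List ℕ) → All (λ u → ¬ (u ∈ U')) U →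
  ∃ λ v → ¬ (v ∈ U) × ¬ (v ∈ U') × All (λ u → E v u) U × All (λ u → ¬ E v u) U'

-- The random graph (any countable graph with the extension property; unique up to iso).
IsRandomGraph : Rel₀ → Set
IsRandomGraph E = IsGraph E × ExtensionProperty E

MapSet : (ℓ : Level) → Set (lsuc ℓ)
MapSet ℓ = (ℕ → ℕ) → Set ℓ

IsMonoid : {ℓ : Level} → MapSet ℓ → Set ℓ
IsMonoid M = M id × (∀ f g → M f → M g → M (f ∘ g))

-- Locally closed: closed in the topology of pointwise convergence on ℕ^ℕ.
LocallyClosed : {ℓ : Level} → MapSet ℓ → Set ℓ
LocallyClosed M =
  (f : ℕ → ℕ) →
  ((A : List ℕ) → Σ (ℕ → ℕ) λ e → M e × All (λ a → e a ≡ f a) A) →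
  M f

LocallyClosedMonoid : {ℓ : Level} → MapSet ℓ → Set ℓ
LocallyClosedMonoid M = IsMonoid M × LocallyClosed M

IsPermutation : (ℕ → ℕ) → Set
IsPermutation f = Σ (ℕ → ℕ) λ g → (∀ x → g (f x) ≡ x) × (∀ x → f (g x) ≡ x)

IsAutomorphism : Rel₀ → (ℕ → ℕ) → Set
IsAutomorphism E f =
  IsPermutation f × (∀ x y → (E x y → E (f x) (f y)) × (E (f x) (f y) → E x y))

Generated : MapSet 0ℓ → MapSet (lsuc 0ℓ)
Generated S f =
  (N : MapSet 0ℓ) → LocallyClosedMonoid N → (∀ g → S g → N g) → N f

Injective : (ℕ → ℕ) → Set
Injective f = ∀ x y → f x ≡ f y → x ≡ y

IsEmbeddingE : Rel₀ → (ℕ → ℕ) → Set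
IsEmbeddingE E f = Injective f × (∀ x y → x ≢ y → E (f x) (f y))

IsEmbeddingN : Rel₀ → (ℕ → ℕ) → Set
IsEmbeddingN E f = Injective f × (∀ x y → ¬ E (f x) (f y))

IsConstant : (ℕ → ℕ) → Set
IsConstant f = ∃ λ c → ∀ x → f x ≡ c

{-# OPTIONS --safe #-}
module Submission where

-- Suppose M contains no constant map, no e_E and no e_N. It suffices that every f ∈ M can be undone
-- on every finite tuple s by some h ∈ M, since then restrictions of members of M form a
-- back-and-forth system. If f(s) cannot be sent back to s, then composing with f over and over
-- yields, for each finite H ⊆ V, some g ∈ M after which no tuple of H can be sent to s. Colour the
-- pairs of H by whether g sends them to equal vertices, edges or non-edges. If H is large, the
-- induced Ramsey theorem, applied once to edges and once to non-edges, gives a copy in H of a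
-- prescribed finite graph A on which all edges get one colour and all non-edges get one colour.
-- Take A to contain s, the complement of s, an induced path on three vertices and its complement:
-- the paths rule out collapsing only edges or only non-edges, the copies of s and its complement
-- rule out that g preserves or complements A, and in the remaining cases g maps A to a point, a
-- clique or an independent set, which is excluded for A large enough.
-- The induced Ramsey theorem follows from the Hales–Jewett theorem by the partite construction.

open import Defs
open import Level using (0ℓ) renaming (suc to lsuc)
open import Axiom.ExcludedMiddle using (ExcludedMiddle)
open import Data.Empty using (⊥-elim)
open import Data.Fin using (Fin; zero; suc; toℕ; funToFin; finToFun; inject≤)
open import Data.Fin.Properties using (finToFun-funToFin; pigeonhole; inject≤-injective)
  renaming (_≟_ to _≟ᶠ_)
open import Data.List
  using (List; []; _∷_; _++_; length; lookup; map; filter; allFin; cartesianProduct; cartesianProductWith)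
open import Data.List.Membership.Propositional using (_∈_)
import Data.List.Membership.DecPropositional as DecMembership
open import Data.List.Membership.Propositional.Properties
  using ( ∈-lookup; ∈-allFin; ∈-filter⁺; ∈-filter⁻; ∈-map⁺; ∈-map⁻; ∈-++⁺ˡ; ∈-++⁺ʳ
        ; ∈-cartesianProduct⁺; ∈-cartesianProductWith⁺)
open import Data.List.Properties using (length-tabulate)
open import Data.List.Relation.Unary.All as All using (All; []; _∷_)
import Data.List.Relation.Unary.All.Properties as All
open import Data.List.Relation.Unary.AllPairs as AllPairs using (AllPairs; []; _∷_)
import Data.List.Relation.Unary.AllPairs.Properties as AllPairs
open import Data.List.Relation.Unary.Any as Any using (here; there)
open import Data.List.Relation.Unary.Any.Properties using (lookup-index)
open import Data.List.Relation.Unary.Unique.Propositional using (Unique)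
open import Data.List.Relation.Unary.Unique.Propositional.Properties using (allFin⁺)
open import Data.Maybe as Maybe using (Maybe; just; nothing; fromMaybe)
open import Data.Nat using (ℕ; zero; suc; _+_; _*_; _^_; _≤_; _<_; z≤n; s≤s; _⊔_; _≤′_; _<′_; ≤′-refl; ≤′-step)
open import Data.Nat.Properties
open import Data.Product using (Σ; ∃; _×_; _,_; proj₁; proj₂; swap)
open import Data.Sum using (_⊎_; inj₁; inj₂)
open import Data.Unit using (⊤; tt)
open import Data.Vec as Vec using (Vec; []; _∷_) renaming (_++_ to _++ᵛ_)
open import Data.Vec.Membership.Propositional using () renaming (_∈_ to _∈ᵛ_)
open import Data.Vec.Properties using (map-++; map-∘; map-cong; map-id)
open import Data.Vec.Relation.Binary.Pointwise.Inductive as Pointwise using (Pointwise; []; _∷_)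
open import Data.Vec.Relation.Unary.Any using (here; there)
import Data.Vec.Relation.Unary.Any.Properties as VecAny
open import Function using (_∘_; id)
open import Relation.Binary using (DecidableEquality)
open import Relation.Binary.Definitions using (tri<; tri≈; tri>)
open import Relation.Binary.PropositionalEquality
open import Relation.Nullary using (¬_; Dec; yes; no; ¬?)

-- The Hales–Jewett theorem

-- The coordinates of a line equal to nothing are its moving coordinates.
Line : ℕ → ℕ → Set
Line k n = Vec (Maybe (Fin k)) n

point : ∀ {A : Set} {n} → A → Vec (Maybe A) n → Vec A n
point a = Vec.map (fromMaybe a)

point-++ : ∀ {A : Set} {m n} (a : A) (K : Vec (Maybe A) m) (L : Vec (Maybe A) n) →
           point a (K ++ᵛ L) ≡ point a K ++ᵛ point a L
point-++ a = map-++ (fromMaybe a)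

point-just : ∀ {A : Set} {n} (a : A) (v : Vec A n) → point a (Vec.map just v) ≡ v
point-just a v = trans (sym (map-∘ (fromMaybe a) just v)) (map-id v)

raise : ∀ {k n} → Line k n → Line (suc k) n
raise = Vec.map (Maybe.map suc)

point-raise : ∀ {k n} (i : Fin k) (L : Line k n) → point (suc i) (raise L) ≡ Vec.map suc (point i L)
point-raise i [] = refl
point-raise i (just _ ∷ L) = cong (_ ∷_) (point-raise i L)
point-raise i (nothing ∷ L) = cong (_ ∷_) (point-raise i L)

raise-moving : ∀ {k n} {L : Line k n} → nothing ∈ᵛ L → nothing ∈ᵛ raise L
raise-moving (here refl) = here refl
raise-moving (there p) = there (raise-moving p)

Monochromatic : ∀ {k n r} → (Vec (Fin k) n → Fin r) → Line k n → Set
Monochromatic χ L = ∀ i j → χ (point i L) ≡ χ (point j L)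

MonochromaticLine : ∀ {k n r} → (Vec (Fin k) n → Fin r) → Set
MonochromaticLine χ = ∃ λ L → nothing ∈ᵛ L × Monochromatic χ L

HalesJewett : ℕ → Set
HalesJewett k = ∀ r → ∃ λ n → (χ : Vec (Fin k) n → Fin r) → MonochromaticLine χ

-- Equals r^(k^n), written as an iterated power so that `code` can follow the recursion on vectors.
#colourings : ℕ → ℕ → ℕ → ℕ
#colourings k r zero = r
#colourings k r (suc n) = #colourings k r n ^ k

-- A whole colouring becomes a single colour, so that the Hales-Jewett theorem applies to colourings
-- whose colours are themselves colourings.
code : ∀ {k r} n → (Vec (Fin k) n → Fin r) → Fin (#colourings k r n)
code zero χ = χ []
code (suc n) χ = funToFin λ i → code n (χ ∘ (i ∷_))

code-injective : ∀ {k r} n (χ ψ : Vec (Fin k) n → Fin r) → code n χ ≡ code n ψ → ∀ v → χ v ≡ ψ v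
code-injective zero χ ψ e [] = e
code-injective (suc n) χ ψ e (i ∷ v) = code-injective n _ _ same v
  where
  same : code n (χ ∘ (i ∷_)) ≡ code n (ψ ∘ (i ∷_))
  same = trans (sym (finToFun-funToFin _ i)) (trans (cong (λ c → finToFun c i) e) (finToFun-funToFin _ i))

Unique-lookup-injective : ∀ {A : Set} {xs : List A} → Unique xs →
                          ∀ i j → lookup xs i ≡ lookup xs j → i ≡ j
Unique-lookup-injective (x∉ ∷ u) zero zero e = refl
Unique-lookup-injective (x∉ ∷ u) zero (suc j) e = ⊥-elim (All.lookup x∉ (∈-lookup j) e)
Unique-lookup-injective (x∉ ∷ u) (suc i) zero e = ⊥-elim (All.lookup x∉ (∈-lookup i) (sym e))
Unique-lookup-injective (x∉ ∷ u) (suc i) (suc j) e = cong suc (Unique-lookup-injective u i j e)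

Unique-length : ∀ {r} (cs : List (Fin r)) → Unique cs → length cs ≤ r
Unique-length {r} cs u with length cs ≤? r
... | yes le = le
... | no gt with i , j , i<j , e ← pigeonhole (≰⇒> gt) (lookup cs) =
  ⊥-elim (<⇒≢ i<j (cong toℕ (Unique-lookup-injective u i j e)))

-- The letter `zero` is set apart: it marks the focus of the line, whose own colour is left open.
FocusedLine : ∀ {k n r} → (Vec (Fin (suc k)) n → Fin r) → Vec (Fin (suc k)) n → Fin r → Set
FocusedLine χ f c = ∃ λ L → nothing ∈ᵛ L × point zero L ≡ f × (∀ i → χ (point (suc i) L) ≡ c)

-- Listing `χ f` among the distinct colours says that no line in the family is already
-- monochromatic.
Focused : ∀ {k n r} → ℕ → (Vec (Fin (suc k)) n → Fin r) → Set
Focused s χ = ∃ λ f → ∃ λ cs → length cs ≡ s × Unique (χ f ∷ cs) × All (FocusedLine χ f) cs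

Focusing : ℕ → ℕ → ℕ → Set
Focusing k r s = ∃ λ n → (χ : Vec (Fin (suc k)) n → Fin r) → MonochromaticLine χ ⊎ Focused s χ

focusing-zero : ∀ {k r} → Focusing k r 0
focusing-zero = 0 , λ χ → inj₂ ([] , [] , refl , ([] ∷ []) , [])

-- Colour each prefix written in nonzero letters by the colouring it induces on suffixes. A
-- monochromatic line for this gives a line `K` whose nonzero points all induce the same `χ′`. Lines
-- focused at `f` for `χ′` are prolonged by `K`, and `K` followed by the fixed suffix `f` is one
-- line more, of colour `χ′ f`.
focusing-suc : ∀ {k r s} → HalesJewett (suc k) → Focusing (suc k) r s → Focusing (suc k) r (suc s)
focusing-suc {k} {r} {s} hj (n , foc) = m + n , λ χ → result χ
  where
  m : ℕ
  m = proj₁ (hj (#colourings (suc (suc k)) r n))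

  module _ (χ : Vec (Fin (suc (suc k))) (m + n) → Fin r) where
    prefixed : Vec (Fin (suc k)) m → Vec (Fin (suc (suc k))) n → Fin r
    prefixed u v = χ (Vec.map suc u ++ᵛ v)

    mono = proj₂ (hj (#colourings (suc (suc k)) r n)) (code n ∘ prefixed)

    L₀ : Line (suc k) m
    L₀ = proj₁ mono

    K : Line (suc (suc k)) m
    K = raise L₀

    K-moving : nothing ∈ᵛ K
    K-moving = raise-moving (proj₁ (proj₂ mono))

    χ′ : Vec (Fin (suc (suc k))) n → Fin r
    χ′ v = χ (point (suc zero) K ++ᵛ v)

    χ-K : ∀ i v → χ (point (suc i) K ++ᵛ v) ≡ χ′ v
    χ-K i v = begin
      χ (point (suc i) K ++ᵛ v)      ≡⟨ cong (λ u → χ (u ++ᵛ v)) (point-raise i L₀) ⟩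
      prefixed (point i L₀) v       ≡⟨ code-injective n _ _ (proj₂ (proj₂ mono) i zero) v ⟩
      prefixed (point zero L₀) v    ≡⟨ cong (λ u → χ (u ++ᵛ v)) (sym (point-raise zero L₀)) ⟩
      χ (point (suc zero) K ++ᵛ v)   ∎
      where open ≡-Reasoning

    monochromatic-suffix : MonochromaticLine χ′ → MonochromaticLine χ
    monochromatic-suffix (L , mov , mc) = Vec.map just u ++ᵛ L , VecAny.++⁺ʳ (Vec.map just u) mov , λ i j →
      trans (cong χ (at i)) (trans (mc i j) (cong χ (sym (at j))))
      where
      u = point (suc zero) K
      at : ∀ i → point i (Vec.map just u ++ᵛ L) ≡ u ++ᵛ point i L
      at i = trans (point-++ i (Vec.map just u) L) (cong (_++ᵛ point i L) (point-just i u))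

    module _ (f : Vec (Fin (suc (suc k))) n) where
      focus : Vec (Fin (suc (suc k))) (m + n)
      focus = point zero K ++ᵛ f

      extended : ∀ {c} → FocusedLine χ′ f c → FocusedLine χ focus c
      extended (L , mov , at₀ , at₊) = K ++ᵛ L , VecAny.++⁺ˡ K-moving
        , trans (point-++ zero K L) (cong (_ ++ᵛ_) at₀)
        , λ i → trans (cong χ (point-++ (suc i) K L)) (trans (χ-K i _) (at₊ i))

      fresh : FocusedLine χ focus (χ′ f)
      fresh = K ++ᵛ Vec.map just f , VecAny.++⁺ˡ K-moving , at zero , λ i → trans (cong χ (at (suc i))) (χ-K i f)
        where
        at : ∀ i → point i (K ++ᵛ Vec.map just f) ≡ point i K ++ᵛ f
        at i = trans (point-++ i K _) (cong (_ ++ᵛ_) (point-just i f))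

    completed : ∀ {f} → FocusedLine χ f (χ f) → MonochromaticLine χ
    completed {f} (L , mov , at₀ , at₊) = L , mov , λ i j → trans (colour i) (sym (colour j))
      where
      colour : ∀ i → χ (point i L) ≡ χ f
      colour zero = cong χ at₀
      colour (suc i) = at₊ i

    result : MonochromaticLine χ ⊎ Focused (suc s) χ
    result with foc χ′
    ... | inj₁ ml = inj₁ (monochromatic-suffix ml)
    ... | inj₂ (f , cs , len , uniq , lines) = conclude (fresh f ∷ All.map (extended f) lines)
      where
      open DecMembership _≟ᶠ_ using (_∈?_)
      conclude : All (FocusedLine χ (focus f)) (χ′ f ∷ cs) → MonochromaticLine χ ⊎ Focused (suc s) χ
      -- The line colours are distinct already. If the colour of the new focus is among them, the
      -- line of that colour is monochromatic; otherwise one more focused line has been gained.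
      conclude lines′ with χ (focus f) ∈? (χ′ f ∷ cs)
      ... | yes c∈ = inj₁ (completed (All.lookup lines′ c∈))
      ... | no c∉ = inj₂ (focus f , χ′ f ∷ cs , cong suc len , All.¬Any⇒All¬ _ c∉ ∷ uniq , lines′)

focusing : ∀ {k} → HalesJewett (suc k) → ∀ r s → Focusing (suc k) r s
focusing hj r zero = focusing-zero
focusing hj r (suc s) = focusing-suc hj (focusing hj r s)

-- With r focused lines, their colours and that of the focus would be r + 1 distinct colours out of
-- r.
hales-jewett-suc : ∀ {k} → HalesJewett (suc k) → HalesJewett (suc (suc k))
hales-jewett-suc hj r with n , foc ← focusing hj r r = n , λ χ → only-line χ (foc χ)
  where
  only-line : ∀ {n} (χ : Vec _ n → Fin r) → MonochromaticLine χ ⊎ Focused r χ → MonochromaticLine χ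
  only-line χ (inj₁ ml) = ml
  only-line χ (inj₂ (f , cs , len , uniq , _)) =
    ⊥-elim (<-irrefl len (Unique-length (χ f ∷ cs) uniq))

opaque
  hales-jewett : ∀ k → HalesJewett k
  hales-jewett zero r = 1 , λ χ → nothing ∷ [] , here refl , λ ()
  hales-jewett (suc zero) r = 1 , λ χ → nothing ∷ [] , here refl , λ { zero zero → refl }
  hales-jewett (suc (suc k)) = hales-jewett-suc (hales-jewett (suc k))

-- Ramsey's theorem for pairs

length-filter-split : ∀ {A C : Set} (_≟_ : DecidableEquality C) (f : A → C) k (xs : List A) →
  length xs ≡ length (filter (λ x → f x ≟ k) xs) + length (filter (λ x → ¬? (f x ≟ k)) xs)
length-filter-split _≟_ f k [] = refl
length-filter-split _≟_ f k (x ∷ xs) with f x ≟ k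
... | yes _ = cong suc (length-filter-split _≟_ f k xs)
... | no _ = trans (cong suc (length-filter-split _≟_ f k xs)) (sym (+-suc _ _))

-- Induction on the colours: a class with fewer than `m` elements is removed together with its
-- colour.
pigeonhole-filter : ∀ {A C : Set} (_≟_ : DecidableEquality C) (ks : List C) m (f : A → C) (xs : List A) →
  All (λ x → f x ∈ ks) xs → length ks * m < length xs →
  ∃ λ k → m ≤ length (filter (λ x → f x ≟ k) xs)
pigeonhole-filter _≟_ [] m f (x ∷ xs) (() ∷ _) lt
pigeonhole-filter {A} _≟_ (k ∷ ks) m f xs col lt with m ≤? length (filter (λ x → f x ≟ k) xs)
... | yes le = k , le
... | no gt = proj₁ rest , ≤-trans (proj₂ rest) (shorter (proj₁ rest) xs)
  where
  others : List A → List A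
  others = filter (λ x → ¬? (f x ≟ k))

  col′ : All (λ x → f x ∈ ks) (others xs)
  col′ = All.zipWith (λ { (here e , ne) → ⊥-elim (ne e) ; (there q , _) → q })
    (All.filter⁺ (λ x → ¬? (f x ≟ k)) col , All.all-filter (λ x → ¬? (f x ≟ k)) xs)

  lt′ : length ks * m < length (others xs)
  lt′ = +-cancelˡ-< m _ _ (<-≤-trans lt
    (≤-trans (≤-reflexive (length-filter-split _≟_ f k xs)) (+-monoˡ-≤ _ (<⇒≤ (≰⇒> gt)))))

  rest : ∃ λ j → m ≤ length (filter (λ x → f x ≟ j) (others xs))
  rest = pigeonhole-filter _≟_ ks m f (others xs) col′ lt′

  shorter : ∀ j ys → length (filter (λ x → f x ≟ j) (others ys)) ≤ length (filter (λ x → f x ≟ j) ys)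
  shorter j [] = z≤n
  shorter j (y ∷ ys) with f y ≟ k
  ... | no _ with f y ≟ j
  ...   | yes _ = s≤s (shorter j ys)
  ...   | no _ = shorter j ys
  shorter j (y ∷ ys) | yes _ with f y ≟ j
  ...   | yes _ = m≤n⇒m≤1+n (shorter j ys)
  ...   | no _ = shorter j ys

pigeonhole-Fin : ∀ {A : Set} {r} m (f : A → Fin r) (xs : List A) → r * m < length xs →
                 ∃ λ k → m ≤ length (filter (λ x → f x ≟ᶠ k) xs)
pigeonhole-Fin {r = r} m f xs lt = pigeonhole-filter _≟ᶠ_ (allFin r) m f xs
  (All.universal (λ x → ∈-allFin (f x)) xs)
  (subst (λ n → n * m < length xs) (sym (length-tabulate {n = r} (λ i → i))) lt)

-- One element becomes the head; more than `r * bound r n` others leave `bound r n` of them in one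
-- colour class.
bound : ℕ → ℕ → ℕ
bound r zero = 0
bound r (suc n) = suc (suc (r * bound r n))

module _ {A : Set} {r} (c : A → A → Fin r) where
  -- The colour of a pair depends on its earlier entry alone and is stored with that entry.
  EndHomogeneous : List (A × Fin r) → Set
  EndHomogeneous = AllPairs (λ (x , k) (y , _) → c x y ≡ k × x ≢ y)

  end-homogeneous : ∀ n xs → Unique xs → bound r n ≤ length xs →
    ∃ λ ys → n ≤ length ys × EndHomogeneous ys × All (λ (y , _) → y ∈ xs) ys
  end-homogeneous zero xs _ _ = [] , z≤n , [] , []
  end-homogeneous (suc n) (x ∷ xs) (x∉ ∷ uniq) (s≤s lt)
    with k , le ← pigeonhole-Fin (bound r n) (c x) xs lt
    with ys , len , hom , sub ← end-homogeneous n _ (AllPairs.filter⁺ (λ y → c x y ≟ᶠ k) uniq) le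
    = (x , k) ∷ ys , s≤s len
    , All.map (λ y∈ → let y∈xs , e = ∈-filter⁻ (λ y → c x y ≟ᶠ k) y∈ in e , All.lookup x∉ y∈xs) sub ∷ hom
    , here refl ∷ All.map (λ y∈ → there (proj₁ (∈-filter⁻ (λ y → c x y ≟ᶠ k) y∈))) sub

AllPairs-lookup : ∀ {A : Set} {R : A → A → Set} → (∀ {x y} → R x y → R y x) →
                  ∀ {xs} → AllPairs R xs → ∀ i j → i ≢ j → R (lookup xs i) (lookup xs j)
AllPairs-lookup sy (rs ∷ ps) zero zero ne = ⊥-elim (ne refl)
AllPairs-lookup sy (rs ∷ ps) zero (suc j) ne = All.lookup rs (∈-lookup j)
AllPairs-lookup sy (rs ∷ ps) (suc i) zero ne = sy (All.lookup rs (∈-lookup i))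
AllPairs-lookup sy (rs ∷ ps) (suc i) (suc j) ne = AllPairs-lookup sy ps i j (ne ∘ cong suc)

opaque
  -- An end-homogeneous list with more than `r * m` entries has `m` entries storing the same colour;
  -- among these all pairs have that colour.
  ramsey : ∀ r m → ∃ λ p → (c : Fin p → Fin p → Fin r) → (∀ a b → c a b ≡ c b a) →
    ∃ λ k → Σ (Fin m → Fin p) λ ι → ∀ i j → i ≢ j → c (ι i) (ι j) ≡ k × ι i ≢ ι j
  ramsey r m = bound r (suc (r * m)) , homogeneous
    where
    homogeneous : (c : Fin (bound r (suc (r * m))) → Fin _ → Fin r) → (∀ a b → c a b ≡ c b a) →
      ∃ λ k → Σ (Fin m → Fin _) λ ι → ∀ i j → i ≢ j → c (ι i) (ι j) ≡ k × ι i ≢ ι j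
    homogeneous c c-sym
      with ys , len , hom , _ ← end-homogeneous c (suc (r * m)) (allFin _) (allFin⁺ _)
                                   (≤-reflexive (sym (length-tabulate (λ i → i))))
      with k , le ← pigeonhole-Fin m proj₂ ys len
      = k , (λ i → proj₁ (pick i)) , λ i j i≢j → separate i j i≢j
      where
      class : List (Fin (bound r (suc (r * m))) × Fin r)
      class = filter (λ y → proj₂ y ≟ᶠ k) ys
      pick : Fin m → Fin (bound r (suc (r * m))) × Fin r
      pick i = lookup class (inject≤ i le)
      R : Fin (bound r (suc (r * m))) × Fin r → Fin (bound r (suc (r * m))) × Fin r → Set
      R (a , _) (b , _) = c a b ≡ k × a ≢ b
      hom-class : AllPairs R class
      hom-class = refine (AllPairs.filter⁺ (λ y → proj₂ y ≟ᶠ k) hom) (All.all-filter (λ y → proj₂ y ≟ᶠ k) ys)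
        where
        refine : ∀ {zs} → EndHomogeneous c zs → All (λ y → proj₂ y ≡ k) zs → AllPairs R zs
        refine [] [] = []
        refine (h ∷ hs) (refl ∷ es) = h ∷ refine hs es
      separate : ∀ i j → i ≢ j → R (pick i) (pick j)
      separate i j i≢j = AllPairs-lookup (λ (e , ne) → trans (c-sym _ _) e , ne ∘ sym) hom-class _ _
        (i≢j ∘ inject≤-injective le le i j)

-- The partite construction

record PartiteGraph (p : ℕ) : Set₁ where
  field
    Vertex : Set
    vertices : List Vertex
    complete : ∀ x → x ∈ vertices
    Adj : Vertex → Vertex → Set
    adj-sym : ∀ {x y} → Adj x y → Adj y x
    part : Vertex → Fin p
    adj-cross : ∀ {x y} → Adj x y → part x ≢ part y

open PartiteGraph

record PartiteEmbedding {p} (P Q : PartiteGraph p) : Set where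
  field
    to : Vertex P → Vertex Q
    to-injective : ∀ {x y} → to x ≡ to y → x ≡ y
    to-part : ∀ x → part Q (to x) ≡ part P x
    to-adj : ∀ {x y} → Adj P x y → Adj Q (to x) (to y)
    from-adj : ∀ {x y} → Adj Q (to x) (to y) → Adj P x y

open PartiteEmbedding

id-embedding : ∀ {p} {P : PartiteGraph p} → PartiteEmbedding P P
id-embedding = record
  { to = λ x → x ; to-injective = λ e → e ; to-part = λ _ → refl ; to-adj = λ a → a ; from-adj = λ a → a }

∘-embedding : ∀ {p} {P Q S : PartiteGraph p} → PartiteEmbedding Q S → PartiteEmbedding P Q → PartiteEmbedding P S
∘-embedding g f = record
  { to = to g ∘ to f
  ; to-injective = to-injective f ∘ to-injective g
  ; to-part = λ x → trans (to-part g _) (to-part f x)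
  ; to-adj = to-adj g ∘ to-adj f
  ; from-adj = from-adj f ∘ from-adj g
  }

PairMonochromatic : ∀ {p} {C : Set} (P : PartiteGraph p) → (Vertex P → Vertex P → C) → Fin p × Fin p → Set
PairMonochromatic P χ (a , b) = ∀ {x y x′ y′} → Adj P x y → Adj P x′ y′ →
  part P x ≡ a → part P y ≡ b → part P x′ ≡ a → part P y′ ≡ b → χ x y ≡ χ x′ y′

Forces : ∀ {p} → ℕ → List (Fin p × Fin p) → PartiteGraph p → PartiteGraph p → Set
Forces r abs P Q = ∀ (χ : Vertex Q → Vertex Q → Fin r) → Σ (PartiteEmbedding P Q) λ ψ →
  ∀ {ab} → ab ∈ abs → PairMonochromatic P (λ x y → χ (to ψ x) (to ψ y)) ab

allVecs : {A : Set} → List A → ∀ n → List (Vec A n)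
allVecs as zero = [] ∷ []
allVecs as (suc n) = cartesianProductWith _∷_ as (allVecs as n)

∈-allVecs : ∀ {A : Set} {as : List A} → (∀ a → a ∈ as) → ∀ {n} (v : Vec A n) → v ∈ allVecs as n
∈-allVecs all [] = here refl
∈-allVecs all (a ∷ v) = ∈-cartesianProductWith⁺ _∷_ (all a) (∈-allVecs all v)

module _ {V : Set} (R : V → V → Set) where
  Compatible : Maybe V → Maybe V → Set
  Compatible nothing _ = ⊤
  Compatible (just _) nothing = ⊤
  Compatible (just x) (just y) = R x y

  compatible-sym : (∀ {x y} → R x y → R y x) → ∀ x y → Compatible x y → Compatible y x
  compatible-sym s nothing nothing _ = tt
  compatible-sym s nothing (just _) _ = tt
  compatible-sym s (just _) nothing _ = tt
  compatible-sym s (just _) (just _) = s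

-- A coordinate nothing is compatible with every vertex, so at the fixed coordinates of a line
-- only the vertices of the two parts under consideration need a value.
power : ∀ {p} → PartiteGraph p → ℕ → PartiteGraph p
power {p} P n = record
  { Vertex = Fin p × Vec (Maybe (Vertex P)) n
  ; vertices = cartesianProduct (allFin p) (allVecs (nothing ∷ map just (vertices P)) n)
  ; complete = λ (c , u) → ∈-cartesianProduct⁺ (∈-allFin c) (∈-allVecs every u)
  ; Adj = λ (c , u) (d , v) → c ≢ d × Pointwise (Compatible (Adj P)) u v
  ; adj-sym = λ (c≢d , q) → c≢d ∘ sym , Pointwise.sym (λ {x} {y} → compatible-sym (Adj P) (adj-sym P) x y) q
  ; part = proj₁
  ; adj-cross = proj₁
  }
  where
  every : ∀ x → x ∈ nothing ∷ map just (vertices P)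
  every nothing = here refl
  every (just x) = there (∈-map⁺ just (complete P x))

module _ (em : ExcludedMiddle 0ℓ) where

  module PartiteStep {p} (r : ℕ) (P : PartiteGraph p) (a b : Fin p) where
    Between : Vertex P × Vertex P → Set
    Between (x , y) = Adj P x y × part P x ≡ a × part P y ≡ b

    edges : List (Vertex P × Vertex P)
    edges = filter (λ e → em {Between e}) (cartesianProduct (vertices P) (vertices P))

    edge : Fin (length edges) → Vertex P × Vertex P
    edge = lookup edges

    edge-between : ∀ i → Between (edge i)
    edge-between i = proj₂ (∈-filter⁻ (λ e → em {Between e}) {xs = cartesianProduct (vertices P) (vertices P)} (∈-lookup i))

    edge-index : ∀ {x y} → Between (x , y) → ∃ λ i → edge i ≡ (x , y)
    edge-index {x} {y} e = Any.index e∈ , sym (lookup-index e∈)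
      where
      e∈ = ∈-filter⁺ (λ e → em {Between e}) (∈-cartesianProduct⁺ (complete P x) (complete P y)) e

    -- The alphabet is the set of edges from part `a` to part `b`. A word of length `n` is read as
    -- two tuples, the first ends and the second ends of its letters.
    n : ℕ
    n = proj₁ (hales-jewett (length edges) r)

    constant : ∀ {c} → Fin (length edges) → Dec (c ≡ a) → Dec (c ≡ b) → Maybe (Vertex P)
    constant i (yes _) _ = just (proj₁ (edge i))
    constant i (no _) (yes _) = just (proj₂ (edge i))
    constant i (no _) (no _) = nothing

    coordinate : Vertex P → Maybe (Fin (length edges)) → Maybe (Vertex P)
    coordinate x nothing = just x
    coordinate x (just i) = constant i (part P x ≟ᶠ a) (part P x ≟ᶠ b)

    -- The only two values other than `nothing` at a fixed coordinate are the ends of one edge, one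
    -- for each of the parts `a` and `b`.
    constant-compatible : ∀ {c d} → c ≢ d → ∀ i ca cb da db →
      Compatible (Adj P) (constant {c} i ca cb) (constant {d} i da db)
    constant-compatible c≢d i (yes refl) cb (yes refl) db = ⊥-elim (c≢d refl)
    constant-compatible c≢d i (yes refl) cb (no _) (yes refl) = proj₁ (edge-between i)
    constant-compatible c≢d i (yes refl) cb (no _) (no _) = tt
    constant-compatible c≢d i (no _) (yes refl) (yes refl) db = adj-sym P (proj₁ (edge-between i))
    constant-compatible c≢d i (no _) (yes refl) (no _) (yes refl) = ⊥-elim (c≢d refl)
    constant-compatible c≢d i (no _) (yes refl) (no _) (no _) = tt
    constant-compatible c≢d i (no _) (no _) da db = tt

    module _ {m} (L : Line (length edges) m) (moving : nothing ∈ᵛ L) where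
      -- At a moving coordinate the image of `x` shows `x` itself, which gives injectivity and
      -- reflection of adjacency.
      along : PartiteEmbedding P (power P m)
      along = record
        { to = λ x → part P x , Vec.map (coordinate x) L
        ; to-injective = λ e → inj moving (cong proj₂ e)
        ; to-part = λ _ → refl
        ; to-adj = λ e → adj-cross P e , compatible e L
        ; from-adj = λ (_ , q) → reflect moving q
        }
        where
        inj : ∀ {x y m} {L : Line _ m} → nothing ∈ᵛ L →
              Vec.map (coordinate x) L ≡ Vec.map (coordinate y) L → x ≡ y
        inj (here refl) refl = refl
        inj (there q) e = inj q (cong Vec.tail e)

        compatible : ∀ {x y m} → Adj P x y → (L : Line _ m) →
                     Pointwise (Compatible (Adj P)) (Vec.map (coordinate x) L) (Vec.map (coordinate y) L)
        compatible e [] = []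
        compatible e (nothing ∷ L) = e ∷ compatible e L
        compatible {x} {y} e (just i ∷ L) =
          constant-compatible (adj-cross P e) i (part P x ≟ᶠ a) (part P x ≟ᶠ b) (part P y ≟ᶠ a) (part P y ≟ᶠ b)
          ∷ compatible e L

        reflect : ∀ {x y m} {L : Line _ m} → nothing ∈ᵛ L →
                  Pointwise (Compatible (Adj P)) (Vec.map (coordinate x) L) (Vec.map (coordinate y) L) → Adj P x y
        reflect (here refl) (e ∷ _) = e
        reflect (there q) (_ ∷ es) = reflect q es

      -- Matches edges with points of the line: the image of edge `i` is read off from the point of
      -- `L` at `i`, so a colouring constant on the points is constant on these edges.
      point-edge : ∀ {x y} → Between (x , y) → ∀ i → edge i ≡ (x , y) →
        (to along x ≡ (a , Vec.map (just ∘ proj₁ ∘ edge) (point i L))) ×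
        (to along y ≡ (b , Vec.map (just ∘ proj₂ ∘ edge) (point i L)))
      point-edge {x} {y} (e , xa , yb) i eq =
        cong₂ _,_ xa (trans (map-cong left L) (map-∘ _ _ L)) , cong₂ _,_ yb (trans (map-cong right L) (map-∘ _ _ L))
        where
        left : ∀ c → coordinate x c ≡ just (proj₁ (edge (fromMaybe i c)))
        left nothing = cong (just ∘ proj₁) (sym eq)
        left (just j) with part P x ≟ᶠ a
        ... | yes _ = refl
        ... | no ne = ⊥-elim (ne xa)
        right : ∀ c → coordinate y c ≡ just (proj₂ (edge (fromMaybe i c)))
        right nothing = cong (just ∘ proj₂) (sym eq)
        right (just j) with part P y ≟ᶠ a | part P y ≟ᶠ b
        ... | yes ya | _ = ⊥-elim (adj-cross P e (trans xa (sym ya)))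
        ... | no _ | yes _ = refl
        ... | no _ | no ne = ⊥-elim (ne yb)

    forces : Forces r ((a , b) ∷ []) P (power P n)
    forces χ with L , moving , mono ← proj₂ (hales-jewett (length edges) r)
        (λ w → χ (a , Vec.map (just ∘ proj₁ ∘ edge) w) (b , Vec.map (just ∘ proj₂ ∘ edge) w))
      = along L moving , λ { (here refl) → pair }
      where
      ψ = along L moving
      colour : ∀ {x y} → Between (x , y) → ∃ λ i →
        χ (to ψ x) (to ψ y) ≡ χ (a , Vec.map (just ∘ proj₁ ∘ edge) (point i L)) (b , Vec.map (just ∘ proj₂ ∘ edge) (point i L))
      colour e with i , eq ← edge-index e with e₁ , e₂ ← point-edge L moving e i eq = i , cong₂ χ e₁ e₂
      pair : PairMonochromatic P (λ x y → χ (to ψ x) (to ψ y)) (a , b)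
      pair e e′ xa yb x′a y′b
        with i , eq ← colour (e , xa , yb) | j , eq′ ← colour (e′ , x′a , y′b) = trans eq (trans (mono i j) (sym eq′))

  opaque
    -- One pair of parts is treated at a time. Passing to a copy of `P` inside the copy of its power
    -- keeps what was achieved for the other pairs, since embeddings respect parts and adjacency.
    partite-forcing : ∀ {p} r (abs : List (Fin p × Fin p)) (P : PartiteGraph p) → ∃ λ Q → Forces r abs P Q
    partite-forcing r [] P = P , λ χ → id-embedding , λ ()
    partite-forcing r ((a , b) ∷ abs) P
      with Q , forceQ ← partite-forcing r abs (power P (PartiteStep.n r P a b)) = Q , force
      where
      force : Forces r ((a , b) ∷ abs) P Q
      force χ with g , monoᵍ ← forceQ χ
        with f , monoᶠ ← PartiteStep.forces r P a b (λ x y → χ (to g x) (to g y))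
        = ∘-embedding g f , λ
          { (here refl) → monoᶠ (here refl)
          ; (there ab∈) → λ e e′ xa yb x′a y′b → monoᵍ ab∈ (to-adj f e) (to-adj f e′)
              (trans (to-part f _) xa) (trans (to-part f _) yb) (trans (to-part f _) x′a) (trans (to-part f _) y′b)
          }

-- Partial isomorphisms and back-and-forth

record PairIso {V W : Set} (R : V → V → Set) (S : W → W → Set) (x x′ : V) (y y′ : W) : Set where
  constructor pairIso
  field
    functional : x ≡ x′ → y ≡ y′
    injective : y ≡ y′ → x ≡ x′
    preserves : R x x′ → S y y′
    reflects : S y y′ → R x x′

open PairIso

PartialIso : {V W : Set} (R : V → V → Set) (S : W → W → Set) → List (V × W) → Set
PartialIso R S ps = ∀ {x x′ y y′} → (x , y) ∈ ps → (x′ , y′) ∈ ps → PairIso R S x x′ y y′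

IsoOn : {V W : Set} (R : V → V → Set) (S : W → W → Set) → List V → (V → W) → Set
IsoOn R S xs f = ∀ {x y} → x ∈ xs → y ∈ xs → PairIso R S x y (f x) (f y)

PairIso-inverse : ∀ {V W R S x x′ y y′} → PairIso {V} {W} R S x x′ y y′ → PairIso S R y y′ x x′
PairIso-inverse (pairIso f i p r) = pairIso i f r p

PairIso-∘ : ∀ {U V W R S T} {x x′ : U} {y y′ : V} {z z′ : W} →
            PairIso S T y y′ z z′ → PairIso R S x x′ y y′ → PairIso R T x x′ z z′
PairIso-∘ (pairIso f i p r) (pairIso f′ i′ p′ r′) = pairIso (f ∘ f′) (i′ ∘ i) (p ∘ p′) (r′ ∘ r)

Undirected : {V : Set} → (V → V → Set) → Set
Undirected R = (∀ x y → R x y → R y x) × (∀ x → ¬ R x x)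

PairIso-sym : ∀ {V W} {R : V → V → Set} {S : W → W → Set} {x x′ y y′} → Undirected R → Undirected S →
              PairIso R S x x′ y y′ → PairIso R S x′ x y′ y
PairIso-sym (rs , _) (ss , _) (pairIso f i p r) =
  pairIso (sym ∘ f ∘ sym) (sym ∘ i ∘ sym) (ss _ _ ∘ p ∘ rs _ _) (rs _ _ ∘ r ∘ ss _ _)

PairIso-refl : ∀ {V W} {R : V → V → Set} {S : W → W → Set} {x y} → Undirected R → Undirected S →
               PairIso R S x x y y
PairIso-refl (_ , ri) (_ , si) = pairIso (λ _ → refl) (λ _ → refl) (⊥-elim ∘ ri _) (⊥-elim ∘ si _)

PartialIso-inverse : ∀ {V W R S ps} → PartialIso {V} {W} R S ps → PartialIso S R (map swap ps)
PartialIso-inverse iso p q with _ , p∈ , refl ← ∈-map⁻ swap p | _ , q∈ , refl ← ∈-map⁻ swap q =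
  PairIso-inverse (iso p∈ q∈)

PartialIso-map : ∀ {I V W : Set} {R S xs} {f : I → V} {u : I → W} →
  (∀ {x y} → x ∈ xs → y ∈ xs → PairIso R S (f x) (f y) (u x) (u y)) → PartialIso R S (map (λ x → f x , u x) xs)
PartialIso-map iso p q with _ , p∈ , refl ← ∈-map⁻ _ p | _ , q∈ , refl ← ∈-map⁻ _ q = iso p∈ q∈

PartialIso-∷ : ∀ {V W} {R : V → V → Set} {S : W → W → Set} → Undirected R → Undirected S →
  ∀ {x y ps} → PartialIso R S ps → (∀ {x′ y′} → (x′ , y′) ∈ ps → PairIso R S x x′ y y′) → PartialIso R S ((x , y) ∷ ps)
PartialIso-∷ uR uS iso new (here refl) (here refl) = PairIso-refl uR uS
PartialIso-∷ uR uS iso new (here refl) (there q) = new q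
PartialIso-∷ uR uS iso new (there p) (here refl) = PairIso-sym uR uS (new p)
PartialIso-∷ uR uS iso new (there p) (there q) = iso p q

-- The system stays abstract because it is used twice: partial isomorphisms yield automorphisms, and
-- finite restrictions of members of a monoid yield permutations.
record BackAndForth (P : List (ℕ × ℕ) → Set) : Set where
  field
    bijective : ∀ {ps x y x′ y′} → P ps → (x , y) ∈ ps → (x′ , y′) ∈ ps → (x ≡ x′ → y ≡ y′) × (y ≡ y′ → x ≡ x′)
    forth : ∀ {ps} → P ps → ∀ x → ∃ λ y → P ((x , y) ∷ ps)
    back : ∀ {ps} → P ps → ∀ y → ∃ λ x → P ((x , y) ∷ ps)

module _ {P : List (ℕ × ℕ) → Set} (bf : BackAndForth P) {start : List (ℕ × ℕ)} (P-start : P start) where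
  open BackAndForth bf

  -- Stage `suc n` puts `n` into the domain and then into the range, so `limit` and its inverse can
  -- be read off from the stage that handles their argument.
  stage : ℕ → ∃ P
  stage zero = start , P-start
  stage (suc n) =
    let _ , good = stage n
        _ , good′ = forth good n
        _ , good″ = back good′ n
    in _ , good″

  pairs : ℕ → List (ℕ × ℕ)
  pairs n = proj₁ (stage n)

  limit limit⁻¹ : ℕ → ℕ
  limit x = proj₁ (forth (proj₂ (stage x)) x)
  limit⁻¹ y = proj₁ (back (proj₂ (forth (proj₂ (stage y)) y)) y)

  pairs-mono : ∀ {m n q} → m ≤′ n → q ∈ pairs m → q ∈ pairs n
  pairs-mono ≤′-refl q∈ = q∈
  pairs-mono (≤′-step le) q∈ = there (there (pairs-mono le q∈))

  at : ∀ {m n q} → m ≤ n → q ∈ pairs m → q ∈ pairs n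
  at le = pairs-mono (≤⇒≤′ le)

  limit-pair : ∀ x → (x , limit x) ∈ pairs (suc x)
  limit-pair x = there (here refl)

  limit⁻¹-pair : ∀ y → (limit⁻¹ y , y) ∈ pairs (suc y)
  limit⁻¹-pair y = here refl

  bijective-at : ∀ {m n x y x′ y′} → (x , y) ∈ pairs m → (x′ , y′) ∈ pairs n →
                 (x ≡ x′ → y ≡ y′) × (y ≡ y′ → x ≡ x′)
  bijective-at {m} {n} p q = bijective (proj₂ (stage (m ⊔ n))) (at (m≤m⊔n m n) p) (at (m≤n⊔m m n) q)

  limit-permutation : IsPermutation limit
  limit-permutation = limit⁻¹
    , (λ x → proj₂ (bijective-at {suc (limit x)} {suc x} (limit⁻¹-pair (limit x)) (limit-pair x)) refl)
    , (λ y → proj₁ (bijective-at {suc (limit⁻¹ y)} {suc y} (limit-pair (limit⁻¹ y)) (limit⁻¹-pair y)) refl)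

  limit-extends : ∀ {x y} → (x , y) ∈ start → limit x ≡ y
  limit-extends {x} p = proj₁ (bijective-at {suc x} {0} (limit-pair x) p) refl

  stage-covering : ∀ xs → ∃ λ n → ∀ {x} → x ∈ xs → (x , limit x) ∈ pairs n
  stage-covering [] = 0 , λ ()
  stage-covering (x ∷ xs) with n , all ← stage-covering xs = suc x ⊔ n , λ
    { (here refl) → at (m≤m⊔n (suc x) n) (limit-pair x)
    ; (there q) → at (m≤n⊔m (suc x) n) (all q) }

  -- Carries properties of members of the system over to the limit: preservation of adjacency, or
  -- agreement with elements of a monoid.
  limit-local : ∀ xs → ∃ λ ps → P ps × (∀ {x} → x ∈ xs → (x , limit x) ∈ ps)
  limit-local xs with n , all ← stage-covering xs = pairs n , proj₂ (stage n) , all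

-- Extension, embedding and homogeneity in the random graph

module _ (em : ExcludedMiddle 0ℓ) where

  module _ {V : Set} {R : V → V → Set} (uR : Undirected R) {E : Rel₀} (rg : IsRandomGraph E) where

    -- The extension property is applied to the images of the neighbours and of the non-neighbours
    -- of `x`, which are disjoint because `ps` is injective. The source is any undirected graph, so
    -- this serves embeddings of finite graphs as well as automorphisms.
    iso-extend : ∀ {ps} → PartialIso R E ps → ∀ x → ∃ λ y → PartialIso R E ((x , y) ∷ ps)
    iso-extend {ps} iso x with em {∃ λ y → (x , y) ∈ ps}
    ... | yes (y , xy∈) = y , PartialIso-∷ uR (proj₁ rg) iso (iso xy∈)
    ... | no x∉ = y , PartialIso-∷ uR (proj₁ rg) iso new
      where
      R? : (p : V × ℕ) → Dec (R x (proj₁ p))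
      R? _ = em
      U U′ : List ℕ
      U = map proj₂ (filter R? ps)
      U′ = map proj₂ (filter (¬? ∘ R?) ps)
      disjoint : ∀ {u} → u ∈ U → ¬ u ∈ U′
      disjoint u∈ u∈′
        with (a , _) , p , refl ← ∈-map⁻ proj₂ u∈ | (b , _) , q , refl ← ∈-map⁻ proj₂ u∈′
        with p∈ , r ← ∈-filter⁻ R? p | q∈ , ¬r ← ∈-filter⁻ (¬? ∘ R?) q
        with refl ← injective (iso p∈ q∈) refl = ¬r r
      ext = proj₂ rg U U′ (All.tabulate disjoint)
      y = proj₁ ext
      new : ∀ {x′ y′} → (x′ , y′) ∈ ps → PairIso R E x x′ y y′
      new {x′} {y′} p with em {R x x′}
      ... | yes r = pairIso (λ { refl → ⊥-elim (x∉ (y′ , p)) }) (λ { refl → ⊥-elim (proj₁ (proj₂ ext) y′∈) })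
                      (λ _ → All.lookup (proj₁ (proj₂ (proj₂ (proj₂ ext)))) y′∈) (λ _ → r)
        where
        y′∈ : y′ ∈ U
        y′∈ = ∈-map⁺ proj₂ (∈-filter⁺ R? p r)
      ... | no ¬r = pairIso (λ { refl → ⊥-elim (x∉ (y′ , p)) }) (λ { refl → ⊥-elim (proj₁ (proj₂ (proj₂ ext)) y′∈) })
                      (⊥-elim ∘ ¬r) (⊥-elim ∘ All.lookup (proj₂ (proj₂ (proj₂ (proj₂ ext)))) y′∈)
        where
        y′∈ : y′ ∈ U′
        y′∈ = ∈-map⁺ proj₂ (∈-filter⁺ (¬? ∘ R?) p ¬r)

    iso-covering : ∀ xs → ∃ λ ps → PartialIso R E ps × (∀ {x} → x ∈ xs → ∃ λ y → (x , y) ∈ ps)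
    iso-covering [] = [] , (λ ()) , λ ()
    iso-covering (x ∷ xs) with ps , iso , dom ← iso-covering xs with y , iso′ ← iso-extend iso x =
      (x , y) ∷ ps , iso′ , λ { (here refl) → y , here refl ; (there q) → let z , z∈ = dom q in z , there z∈ }

    opaque
      embed : ∀ xs → ∃ λ f → IsoOn R E xs f
      embed xs with ps , iso , dom ← iso-covering xs = f , λ x∈ y∈ → iso (f-pair (dom x∈)) (f-pair (dom y∈))
        where
        f : V → ℕ
        f x with em {∃ λ y → (x , y) ∈ ps}
        ... | yes (y , _) = y
        ... | no _ = 0
        f-pair : ∀ {x} → (∃ λ y → (x , y) ∈ ps) → (x , f x) ∈ ps
        f-pair {x} d with em {∃ λ y → (x , y) ∈ ps}
        ... | yes (_ , p) = p
        ... | no ¬d = ⊥-elim (¬d d)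

  module _ {E : Rel₀} (rg : IsRandomGraph E) where

    iso-back-and-forth : BackAndForth (PartialIso E E)
    iso-back-and-forth = record
      { bijective = λ iso p q → functional (iso p q) , injective (iso p q)
      ; forth = iso-extend (proj₁ rg) rg
      ; back = back
      }
      where
      unswap : ∀ {p : ℕ × ℕ} {ps} → p ∈ ps → swap p ∈ map swap ps
      unswap = ∈-map⁺ swap
      back : ∀ {ps} → PartialIso E E ps → ∀ y → ∃ λ x → PartialIso E E ((x , y) ∷ ps)
      back {ps} iso y with x , iso′ ← iso-extend (proj₁ rg) rg (PartialIso-inverse {ps = ps} iso) y =
        x , λ p q → PairIso-inverse (iso′ (unswap p) (unswap q))

    opaque
      homogeneous : ∀ {ps} → PartialIso E E ps → ∃ λ α → IsAutomorphism E α × (∀ {x y} → (x , y) ∈ ps → α x ≡ y)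
      homogeneous {ps} iso = α , (limit-permutation bf start , auto) , limit-extends bf start
        where
        bf : BackAndForth (PartialIso E E)
        bf = iso-back-and-forth
        start : PartialIso E E ps
        start = iso
        α : ℕ → ℕ
        α = limit bf start
        auto : ∀ x y → (E x y → E (α x) (α y)) × (E (α x) (α y) → E x y)
        auto x y with ps , good , all ← limit-local bf start (x ∷ y ∷ []) =
          let pi = good (all (here refl)) (all (there (here refl))) in preserves pi , reflects pi

-- Induced Ramsey theorems for the random graph

Co : Rel₀ → Rel₀
Co E x y = x ≢ y × ¬ E x y

-- Taking position `i` from copy `ι i`, with `ι` injective, gives a transversal induced copy of `A`.
blowUp : ∀ {E} → IsGraph E → List ℕ → ∀ p → PartiteGraph p
blowUp {E} (E-sym , _) A p = record
  { Vertex = Fin p × Fin (length A)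
  ; vertices = cartesianProduct (allFin p) (allFin (length A))
  ; complete = λ (c , i) → ∈-cartesianProduct⁺ (∈-allFin c) (∈-allFin i)
  ; Adj = λ (c , i) (d , j) → c ≢ d × E (lookup A i) (lookup A j)
  ; adj-sym = λ (c≢d , e) → c≢d ∘ sym , E-sym _ _ e
  ; part = proj₁
  ; adj-cross = proj₁
  }

MonochromaticOn : ∀ {r} → Rel₀ → (ℕ → ℕ → Fin r) → List ℕ → (ℕ → ℕ) → Set
MonochromaticOn S χ A φ = ∃ λ k → ∀ {x y} → x ∈ A → y ∈ A → S x y → χ (φ x) (φ y) ≡ k

InducedCopy : Rel₀ → List ℕ → List ℕ → (ℕ → ℕ) → Set
InducedCopy E A H φ = (∀ {x} → x ∈ A → φ x ∈ H) × IsoOn E E A φ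

CanonicalCopy : ∀ {r} → Rel₀ → (ℕ → ℕ → Fin r) → List ℕ → List ℕ → Set
CanonicalCopy E χ A H = ∃ λ φ → InducedCopy E A H φ × MonochromaticOn E χ A φ × MonochromaticOn (Co E) χ A φ

module _ (em : ExcludedMiddle 0ℓ) where

  -- The partite construction makes the colour of an edge depend only on the two parts it joins.
  -- Ramsey's theorem for the parts then finds one part for each position of `A` with a single
  -- colour throughout, and the transversal copy of `A` lies in these.
  edge-ramsey : ∀ {E} → IsRandomGraph E → ∀ r A →
    ∃ λ H → (χ : ℕ → ℕ → Fin r) → (∀ x y → χ x y ≡ χ y x) →
    ∃ λ φ → InducedCopy E A H φ × MonochromaticOn E χ A φ
  edge-ramsey {E} rg@(graph , _) r A = map e (vertices Q) , λ χ χ-sym →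
    let open Coloured χ χ-sym in φ , (φ-image , φ-iso) , k , φ-colour
    where
    m p : ℕ
    m = length A
    p = proj₁ (ramsey r m)

    P : PartiteGraph p
    P = blowUp graph A p

    forcing : ∃ λ Q → Forces r (cartesianProduct (allFin p) (allFin p)) P Q
    forcing = partite-forcing em r _ P

    Q = proj₁ forcing

    embedding : ∃ λ e → IsoOn (Adj Q) E (vertices Q) e
    embedding = embed em ((λ _ _ → adj-sym Q) , λ _ a → adj-cross Q a refl) rg (vertices Q)

    e : Vertex Q → ℕ
    e = proj₁ embedding

    e-iso : ∀ x y → PairIso (Adj Q) E x y (e x) (e y)
    e-iso x y = proj₂ embedding (complete Q x) (complete Q y)

    module Coloured (χ : ℕ → ℕ → Fin r) (χ-sym : ∀ x y → χ x y ≡ χ y x) where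
      ψ : PartiteEmbedding P Q
      ψ = proj₁ (proj₂ forcing (λ x y → χ (e x) (e y)))

      X : Fin p → Fin m → ℕ
      X c i = e (to ψ (c , i))

      mono : ∀ {a b} → PairMonochromatic P (λ x y → χ (e (to ψ x)) (e (to ψ y))) (a , b)
      mono {a} {b} = proj₂ (proj₂ forcing (λ x y → χ (e x) (e y))) (∈-cartesianProduct⁺ (∈-allFin a) (∈-allFin b))

      PartColouring : (Fin p → Fin p → Fin r) → Set
      PartColouring c = (∀ a b → c a b ≡ c b a) ×
        (∀ {a b i j} → a ≢ b → E (lookup A i) (lookup A j) → χ (X a i) (X b j) ≡ c a b)

      partColouring : ∃ PartColouring
      partColouring with em {∃ λ i → ∃ λ j → E (lookup A i) (lookup A j)}
      -- Without edges in `A` the condition is vacuous and any constant colour serves.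
      ... | no none = (λ _ _ → χ 0 0) , (λ _ _ → refl) , λ _ edge → ⊥-elim (none (_ , _ , edge))
      ... | yes (i₀ , j₀ , e₀) = (λ a b → χ (X a i₀) (X b j₀)) , symmetric
                               , λ a≢b edge → mono (a≢b , edge) (a≢b , e₀) refl refl refl refl
        where
        symmetric : ∀ a b → χ (X a i₀) (X b j₀) ≡ χ (X b i₀) (X a j₀)
        symmetric a b with a ≟ᶠ b
        ... | yes refl = refl
        -- The reversed sample edge, from `X a j₀` to `X b i₀`, joins the same two parts.
        ... | no a≢b = trans (mono (a≢b , e₀) (a≢b , proj₁ graph _ _ e₀) refl refl refl refl) (χ-sym _ _)

      c = proj₁ partColouring

      homogeneous-parts : ∃ λ k → Σ (Fin m → Fin p) λ ι → ∀ i j → i ≢ j → c (ι i) (ι j) ≡ k × ι i ≢ ι j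
      homogeneous-parts = proj₂ (ramsey r m) c (proj₁ (proj₂ partColouring))

      k = proj₁ homogeneous-parts
      ι = proj₁ (proj₂ homogeneous-parts)
      ι-spec = proj₂ (proj₂ homogeneous-parts)

      -- Excluded middle fixes one position for each element, so repeated entries of `A` do no harm.
      φ : ℕ → ℕ
      φ x with em {x ∈ A}
      ... | yes x∈ = X (ι (Any.index x∈)) (Any.index x∈)
      ... | no _ = 0

      φ-spec : ∀ {x} → x ∈ A → ∃ λ i → x ≡ lookup A i × φ x ≡ X (ι i) i
      φ-spec {x} x∈′ with em {x ∈ A}
      ... | yes x∈ = Any.index x∈ , lookup-index x∈ , refl
      ... | no x∉ = ⊥-elim (x∉ x∈′)

      distinct : ∀ {i j} → E (lookup A i) (lookup A j) → i ≢ j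
      distinct edge refl = proj₂ graph _ edge

      φ-iso : IsoOn E E A φ
      φ-iso {x} {y} x∈ y∈ with i , refl , eq ← φ-spec x∈ | j , refl , eq′ ← φ-spec y∈ =
        pairIso (cong φ) inj (λ edge → subst₂ E (sym eq) (sym eq′) (pres edge)) (refl′ ∘ subst₂ E eq eq′)
        where
        inj : φ x ≡ φ y → x ≡ y
        inj eqφ = cong (lookup A ∘ proj₂)
          (to-injective ψ {ι i , i} {ι j , j} (injective (e-iso _ _) (trans (sym eq) (trans eqφ eq′))))
        pres : E x y → E (X (ι i) i) (X (ι j) j)
        pres edge = preserves (e-iso _ _) (to-adj ψ (proj₂ (ι-spec i j (distinct edge)) , edge))
        refl′ : E (X (ι i) i) (X (ι j) j) → E x y
        refl′ edge = proj₂ (from-adj ψ {ι i , i} {ι j , j} (reflects (e-iso _ _) edge))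

      φ-colour : ∀ {x y} → x ∈ A → y ∈ A → E x y → χ (φ x) (φ y) ≡ k
      φ-colour x∈ y∈ edge with i , refl , eq ← φ-spec x∈ | j , refl , eq′ ← φ-spec y∈
        with ck , ι≢ ← ι-spec i j (distinct edge) =
        trans (cong₂ χ eq eq′) (trans (proj₂ (proj₂ partColouring) ι≢ edge) ck)

      φ-image : ∀ {x} → x ∈ A → φ x ∈ map e (vertices Q)
      φ-image x∈ with i , _ , eq ← φ-spec x∈ = subst (_∈ _) (sym eq) (∈-map⁺ e (complete Q _))

  E-or-Co : ∀ {E x y} → x ≢ y → E x y ⊎ Co E x y
  E-or-Co {E} {x} {y} x≢y with em {E x y}
  ... | yes edge = inj₁ edge
  ... | no ¬edge = inj₂ (x≢y , ¬edge)

  -- The extension property is self-dual: exchange `U` and `U′`.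
  Co-random : ∀ {E} → IsRandomGraph E → IsRandomGraph (Co E)
  Co-random {E} ((E-sym , _) , ext) =
    ((λ x y (ne , ¬e) → ne ∘ sym , ¬e ∘ E-sym y x) , λ x (ne , _) → ne refl) , co-ext
    where
    co-ext : ExtensionProperty (Co E)
    co-ext U U′ disjoint
      with v , v∉U′ , v∉U , adj , nonadj ← ext U′ U (All.tabulate λ u∈U′ u∈U → All.lookup disjoint u∈U u∈U′)
      = v , v∉U , v∉U′
      , All.tabulate (λ u∈ → (λ { refl → v∉U u∈ }) , All.lookup nonadj u∈)
      , All.map (λ edge co → proj₂ co edge) adj

  Co-iso : ∀ {E x y a b} → IsGraph E → PairIso (Co E) (Co E) x y a b → PairIso E E x y a b
  Co-iso {E} {x} {y} {a} {b} (_ , E-irrefl) iso = pairIso (functional iso) (injective iso) pres refl′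
    where
    pres : E x y → E a b
    pres edge with E-or-Co {E} {a} {b} (λ a≡b → E-irrefl y (subst (λ z → E z y) (injective iso a≡b) edge))
    ... | inj₁ edge′ = edge′
    ... | inj₂ co = ⊥-elim (proj₂ (reflects iso co) edge)
    refl′ : E a b → E x y
    refl′ edge with E-or-Co {E} {x} {y} (λ x≡y → E-irrefl b (subst (λ z → E z b) (functional iso x≡y) edge))
    ... | inj₁ edge′ = edge′
    ... | inj₂ co = ⊥-elim (proj₂ (preserves iso co) edge)

  opaque
    -- `H₁` controls the non-edges of `A`, as edges of the complement, and `H₂` controls the edges
    -- of `H₁`. A copy of `A` inside a copy of `H₁` inherits the edge colour of the latter.
    canonical-ramsey : ∀ {E} → IsRandomGraph E → ∀ r A →
      ∃ λ H → (χ : ℕ → ℕ → Fin r) → (∀ x y → χ x y ≡ χ y x) → CanonicalCopy E χ A H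
    canonical-ramsey {E} rg r A
      with H₁ , ramsey₁ ← edge-ramsey (Co-random rg) r A
      with H₂ , ramsey₂ ← edge-ramsey rg r H₁ = H₂ , canonical
      where
      canonical : (χ : ℕ → ℕ → Fin r) → (∀ x y → χ x y ≡ χ y x) → CanonicalCopy E χ A H₂
      canonical χ χ-sym
        with φ₂ , (into₂ , iso₂) , k , colour ← ramsey₂ χ χ-sym
        with φ₁ , (into₁ , iso₁) , k′ , colour′ ← ramsey₁ (λ x y → χ (φ₂ x) (φ₂ y)) (λ _ _ → χ-sym _ _)
        = φ₂ ∘ φ₁
        , (into₂ ∘ into₁ , λ x∈ y∈ → PairIso-∘ (iso₂ (into₁ x∈) (into₁ y∈)) (iso₁′ x∈ y∈))
        , (k , λ x∈ y∈ edge → colour (into₁ x∈) (into₁ y∈) (preserves (iso₁′ x∈ y∈) edge))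
        , (k′ , colour′)
        where
        iso₁′ : IsoOn E E A φ₁
        iso₁′ x∈ y∈ = Co-iso (proj₁ rg) (iso₁ x∈ y∈)

-- Cliques, paths and lists of maps

module _ {S : Rel₀} (rg : IsRandomGraph S) where

  common-neighbour : ∀ xs → ∃ λ v → ∀ {x} → x ∈ xs → S v x
  common-neighbour xs with v , _ , _ , adj , _ ← proj₂ rg xs [] (All.universal (λ _ ()) xs) = v , All.lookup adj

  -- Greedy choice of an infinite clique; applied to `Co E` it yields an infinite independent set.
  clique-prefix : ℕ → List ℕ
  clique-prefix zero = []
  clique-prefix (suc n) = proj₁ (common-neighbour (clique-prefix n)) ∷ clique-prefix n

  clique : ℕ → ℕ
  clique n = proj₁ (common-neighbour (clique-prefix n))

  clique-prefix-mono : ∀ {m n} → m <′ n → clique m ∈ clique-prefix n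
  clique-prefix-mono ≤′-refl = here refl
  clique-prefix-mono (≤′-step le) = there (clique-prefix-mono le)

  clique-adjacent : ∀ {m n} → m ≢ n → S (clique m) (clique n)
  clique-adjacent {m} {n} m≢n with <-cmp m n
  ... | tri< lt _ _ = proj₁ (proj₁ rg) _ _ (proj₂ (common-neighbour (clique-prefix n)) (clique-prefix-mono (≤⇒≤′ lt)))
  ... | tri≈ _ m≡n _ = ⊥-elim (m≢n m≡n)
  ... | tri> _ _ lt = proj₂ (common-neighbour (clique-prefix m)) (clique-prefix-mono (≤⇒≤′ lt))

  clique-injective : ∀ m n → clique m ≡ clique n → m ≡ n
  clique-injective m n eq with m ≟ n
  ... | yes m≡n = m≡n
  ... | no m≢n = ⊥-elim (proj₂ (proj₁ rg) _ (subst (S (clique m)) (sym eq) (clique-adjacent m≢n)))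

  opaque
    induced-path : ∃ λ x → ∃ λ y → ∃ λ z → S x y × S y z × Co S x z
    induced-path
      with y , _ ← common-neighbour []
      with x , xy ← common-neighbour (y ∷ [])
      with z , _ , z∉ , zy ∷ [] , ¬zx ∷ [] ← proj₂ rg (y ∷ []) (x ∷ [])
             ((λ { (here refl) → proj₂ (proj₁ rg) _ (xy (here refl)) }) ∷ [])
      = x , y , z , xy (here refl) , proj₁ (proj₁ rg) _ _ zy , (λ { refl → z∉ (here refl) }) , ¬zx ∘ proj₁ (proj₁ rg) _ _

updated : (ℕ → ℕ) → ℕ → ℕ → ℕ → ℕ
updated u x y z with z ≟ x
... | yes _ = y
... | no _ = u z

-- Represents the maps from `xs` to `ys` up to agreement on `xs`, so that all tuples of a finite set
-- can be treated one by one.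
maps : List ℕ → List ℕ → List (ℕ → ℕ)
maps [] ys = id ∷ []
maps (x ∷ xs) ys = cartesianProductWith (λ u y → updated u x y) (maps xs ys) ys

maps-complete : ∀ xs {ys} (u : ℕ → ℕ) → (∀ {x} → x ∈ xs → u x ∈ ys) → ∃ λ v → v ∈ maps xs ys × (∀ {x} → x ∈ xs → v x ≡ u x)
maps-complete [] u into = id , here refl , λ ()
maps-complete (x ∷ xs) {ys} u into with v , v∈ , eq ← maps-complete xs u (into ∘ there) =
  updated v x (u x) , ∈-cartesianProductWith⁺ (λ u y → updated u x y) v∈ (into (here refl)) , agree
  where
  agree : ∀ {z} → z ∈ x ∷ xs → updated v x (u x) z ≡ u z
  agree {z} z∈ with z ≟ x | z∈
  ... | yes refl | _ = refl
  ... | no z≢x | here z≡x = ⊥-elim (z≢x z≡x)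
  ... | no z≢x | there z∈xs = eq z∈xs

both-adjacent : ∀ {S : Rel₀} {x y a b} → IsGraph S → S x y → S a b → PairIso S S x y a b
both-adjacent (_ , irrefl) xy ab = pairIso
  (λ { refl → ⊥-elim (irrefl _ xy) }) (λ { refl → ⊥-elim (irrefl _ ab) }) (λ _ → ab) (λ _ → xy)

-- Locally closed monoids containing the automorphism group

module _ (em : ExcludedMiddle 0ℓ) where

  ¬∀⇒∃¬ : {A : Set} {P : A → Set} → ¬ (∀ x → P x) → ∃ λ x → ¬ P x
  ¬∀⇒∃¬ {P = P} ¬all with em {∃ λ x → ¬ P x}
  ... | yes found = found
  ... | no none = ⊥-elim (¬all λ x → case x (em {P x}))
    where
    case : ∀ x → Dec (P x) → P x
    case x (yes px) = px
    case x (no ¬px) = ⊥-elim (none (x , ¬px))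

  module Monoid {E : Rel₀} (rg : IsRandomGraph E) {M : MapSet 0ℓ} (lcm : LocallyClosedMonoid M)
                (aut : ∀ α → IsAutomorphism E α → M α) where
    graph : IsGraph E
    graph = proj₁ rg

    rgᶜ : IsRandomGraph (Co E)
    rgᶜ = Co-random em rg

    M-∘ : ∀ {f g} → M f → M g → M (f ∘ g)
    M-∘ = proj₂ (proj₁ lcm) _ _

    closed : ∀ {f} → (∀ xs → ∃ λ g → M g × (∀ {x} → x ∈ xs → g x ≡ f x)) → M f
    closed approx = proj₂ lcm _ λ xs → let g , mg , eq = approx xs in g , mg , All.tabulate eq

    AgreesOn : List ℕ → (ℕ → ℕ) → Set
    AgreesOn xs u = ∃ λ h → M h × (∀ {x} → x ∈ xs → h x ≡ u x)

    Invertible : List ℕ → (ℕ → ℕ) → Set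
    Invertible xs u = ∃ λ h → M h × (∀ {x} → x ∈ xs → h (u x) ≡ x)

    opaque
      -- Homogeneity: tuples of the same isomorphism type are related by an automorphism, hence by a
      -- member of `M`.
      transport : ∀ {xs} {f u : ℕ → ℕ} →
        (∀ {x y} → x ∈ xs → y ∈ xs → PairIso E E (f x) (f y) (u x) (u y)) →
        ∃ λ α → M α × (∀ {x} → x ∈ xs → α (f x) ≡ u x)
      transport iso with α , auto , eq ← homogeneous em rg (PartialIso-map iso) =
        α , aut α auto , λ x∈ → eq (∈-map⁺ _ x∈)

    module Symmetric (undo : ∀ f → M f → ∀ xs → Invertible xs f) where
      Restriction : List (ℕ × ℕ) → Set
      Restriction ps = ∃ λ f → M f × (∀ {x y} → (x , y) ∈ ps → f x ≡ y)

      restriction-back : ∀ {ps} → Restriction ps → ∃ λ h → M h × (∀ {x y} → (x , y) ∈ ps → h y ≡ x)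
      restriction-back {ps} (f , mf , eq) with h , mh , inv ← undo f mf (map proj₁ ps) =
        h , mh , λ p → trans (cong h (sym (eq p))) (inv (∈-map⁺ proj₁ p))

      restriction-system : BackAndForth Restriction
      restriction-system = record { bijective = bij ; forth = forth ; back = back }
        where
        bij : ∀ {ps x y x′ y′} → Restriction ps → (x , y) ∈ ps → (x′ , y′) ∈ ps → (x ≡ x′ → y ≡ y′) × (y ≡ y′ → x ≡ x′)
        bij res@(f , _ , eq) p q with h , _ , eqʰ ← restriction-back res =
          (λ e → trans (sym (eq p)) (trans (cong f e) (eq q))) , (λ e → trans (sym (eqʰ p)) (trans (cong h e) (eqʰ q)))
        forth : ∀ {ps} → Restriction ps → ∀ x → ∃ λ y → Restriction ((x , y) ∷ ps)
        forth (f , mf , eq) x = f x , f , mf , λ { (here refl) → refl ; (there p) → eq p }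
        back : ∀ {ps} → Restriction ps → ∀ y → ∃ λ x → Restriction ((x , y) ∷ ps)
        -- `h` undoes the restriction, and the new `f` undoes `h` on the old range together with
        -- `y`; it extends the old pairs and sends `h y` to `y`.
        back {ps} res y with h , mh , eqʰ ← restriction-back res with f , mf , inv ← undo h mh (y ∷ map proj₂ ps) =
          h y , f , mf , λ
            { (here refl) → inv (here refl)
            ; (there p) → trans (cong f (sym (eqʰ p))) (inv (there (∈-map⁺ proj₂ p))) }

      -- Each finite part of the limit agrees with a member of `M`, so local closure puts the limit
      -- itself into `M`.
      permutation-through : ∀ f → M f → ∀ xs → ∃ λ g → (M g × IsPermutation g) × (∀ {x} → x ∈ xs → g x ≡ f x)
      permutation-through f mf xs =
        g , (closed approx , limit-permutation restriction-system start) , λ x∈ → limit-extends restriction-system start (∈-map⁺ _ x∈)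
        where
        restrict : ∀ {x y} → (x , y) ∈ map (λ x → x , f x) xs → f x ≡ y
        restrict p with _ , _ , refl ← ∈-map⁻ _ p = refl
        start : Restriction (map (λ x → x , f x) xs)
        start = f , mf , restrict
        g = limit restriction-system start
        approx : ∀ ys → AgreesOn ys g
        approx ys with _ , (h , mh , eq) , all ← limit-local restriction-system start ys = h , mh , eq ∘ all

      generated : ∀ f → M f → Generated (λ g → M g × IsPermutation g) f
      generated f mf N (_ , closedN) incl = closedN f λ xs →
        let g , mg , eq = permutation-through f mf xs in g , incl g mg , All.tabulate eq

    -- Composing with f after returning to the identity on xs makes one more tuple non-invertible.
    avoid : ∀ {f xs} → M f → ¬ Invertible xs f → ∀ us →
            ∃ λ g → M g × (∀ {u} → u ∈ us → ¬ Invertible xs (g ∘ u))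
    avoid mf ¬inv [] = id , proj₁ (proj₁ lcm) , λ ()
    avoid {f} {xs} mf ¬inv (u ∷ us) with g , mg , dead ← avoid mf ¬inv us with em {Invertible xs (g ∘ u)}
    ... | no ¬inv′ = g , mg , λ { (here refl) → ¬inv′ ; (there v∈) → dead v∈ }
    ... | yes (k , mk , inv) = f ∘ k ∘ g , M-∘ mf (M-∘ mk mg) , λ
      { (here refl) (h , mh , eq) → ¬inv (h , mh , λ x∈ → trans (cong (h ∘ f) (sym (inv x∈))) (eq x∈))
      -- Earlier tuples stay non-invertible: `f ∘ k` would be absorbed into the inverse.
      ; (there v∈) (h , mh , eq) → dead v∈ (h ∘ f ∘ k , M-∘ mh (M-∘ mf mk) , eq) }

    avoid-into : ∀ {f xs} → M f → ¬ Invertible xs f → ∀ H →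
                 ∃ λ g → M g × (∀ u → (∀ {x} → x ∈ xs → u x ∈ H) → ¬ Invertible xs (g ∘ u))
    avoid-into {xs = xs} mf ¬inv H with g , mg , dead ← avoid mf ¬inv (maps xs H) =
      g , mg , λ u into (h , mh , eq) → let v , v∈ , v≡u = maps-complete xs u into in
        dead v∈ (h , mh , λ x∈ → trans (cong (h ∘ g) (v≡u x∈)) (eq x∈))

    ConstantOn : List ℕ → (ℕ → ℕ) → Set
    ConstantOn xs f = ∀ {x y} → x ∈ xs → y ∈ xs → f x ≡ f y

    CliqueOn : Rel₀ → List ℕ → (ℕ → ℕ) → Set
    CliqueOn S xs f = ∀ {x y} → x ∈ xs → y ∈ xs → x ≢ y → S (f x) (f y)

    -- An automorphism corrects the values of `f` on `xs` to those of `u`; local closure does the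
    -- rest.
    approximable : ∀ {u} → (∀ xs → ∃ λ f → M f × (∀ {x y} → x ∈ xs → y ∈ xs → PairIso E E (f x) (f y) (u x) (u y))) → M u
    approximable approx = closed λ xs →
      let f , mf , iso = approx xs
          α , mα , eq = transport {xs} {f} iso
      in α ∘ f , M-∘ mα mf , eq

    constant∈M : (∀ xs → ∃ λ f → M f × ConstantOn xs f) → M (λ _ → 0)
    constant∈M approx = approximable λ xs → let f , mf , const = approx xs in
      f , mf , λ {x} x∈ y∈ → subst (λ z → PairIso E E (f x) z 0 0) (const x∈ y∈) (PairIso-refl graph graph)

    clique∈M : ∀ {S} (rgS : IsRandomGraph S) → (∀ {x y a b} → PairIso S S x y a b → PairIso E E x y a b) →
               (∀ xs → ∃ λ f → M f × CliqueOn S xs f) → M (clique rgS)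
    clique∈M {S} rgS toE approx = approximable λ xs → let f , mf , cl = approx xs in f , mf , iso f cl
      where
      iso : ∀ {xs} f → CliqueOn S xs f → ∀ {x y} → x ∈ xs → y ∈ xs → PairIso E E (f x) (f y) (clique rgS x) (clique rgS y)
      iso f cl {x} {y} x∈ y∈ with x ≟ y
      ... | yes refl = PairIso-refl graph graph
      ... | no x≢y = toE (both-adjacent (proj₁ rgS) (cl x∈ y∈ x≢y) (clique-adjacent rgS x≢y))

    -- The three orbits of the automorphism group on ordered pairs, used as Ramsey colours.
    Meets : Fin 3 → ℕ → ℕ → Set
    Meets zero a b = a ≡ b
    Meets (suc zero) a b = E a b
    Meets (suc (suc zero)) a b = Co E a b

    Meets-sym : ∀ k {a b} → Meets k a b → Meets k b a
    Meets-sym zero = sym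
    Meets-sym (suc zero) = proj₁ graph _ _
    Meets-sym (suc (suc zero)) = proj₁ (proj₁ rgᶜ) _ _

    Meets-unique : ∀ k l {a b} → Meets k a b → Meets l a b → k ≡ l
    Meets-unique zero zero _ _ = refl
    Meets-unique zero (suc zero) refl e = ⊥-elim (proj₂ graph _ e)
    Meets-unique zero (suc (suc zero)) refl (ne , _) = ⊥-elim (ne refl)
    Meets-unique (suc zero) zero e refl = ⊥-elim (proj₂ graph _ e)
    Meets-unique (suc zero) (suc zero) _ _ = refl
    Meets-unique (suc zero) (suc (suc zero)) e (_ , ¬e) = ⊥-elim (¬e e)
    Meets-unique (suc (suc zero)) zero (ne , _) refl = ⊥-elim (ne refl)
    Meets-unique (suc (suc zero)) (suc zero) (_ , ¬e) e = ⊥-elim (¬e e)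
    Meets-unique (suc (suc zero)) (suc (suc zero)) _ _ = refl

    meets : ∀ a b → ∃ λ k → Meets k a b
    meets a b with a ≟ b
    ... | yes a≡b = zero , a≡b
    ... | no a≢b with E-or-Co em {E} a≢b
    ...   | inj₁ edge = suc zero , edge
    ...   | inj₂ co = suc (suc zero) , co

    kind : ℕ → ℕ → Fin 3
    kind a b = proj₁ (meets a b)

    kind-meets : ∀ {a b k} → kind a b ≡ k → Meets k a b
    kind-meets {a} {b} refl = proj₂ (meets a b)

    kind-sym : ∀ a b → kind a b ≡ kind b a
    kind-sym a b = Meets-unique _ _ (proj₂ (meets a b)) (Meets-sym (kind b a) (proj₂ (meets b a)))

    module _ {u : ℕ → ℕ} {x y : ℕ} where
      pair-iso : (E x y → E (u x) (u y)) → (Co E x y → Co E (u x) (u y)) → PairIso E E x y (u x) (u y)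
      pair-iso pres presᶜ with x ≟ y
      ... | yes refl = PairIso-refl graph graph
      ... | no x≢y with E-or-Co em {E} x≢y
      ...   | inj₁ e = both-adjacent graph e (pres e)
      ...   | inj₂ co = Co-iso em graph (both-adjacent (proj₁ rgᶜ) co (presᶜ co))

    SendsOn : List ℕ → Fin 3 → Fin 3 → (ℕ → ℕ) → Set
    SendsOn A k l f = (∀ {x y} → x ∈ A → y ∈ A → E x y → Meets k (f x) (f y)) ×
                      (∀ {x y} → x ∈ A → y ∈ A → Co E x y → Meets l (f x) (f y))

    Meets-irrefl : ∀ k {a} → ¬ Meets (suc k) a a
    Meets-irrefl zero = proj₂ graph _
    Meets-irrefl (suc zero) (ne , _) = ne refl

    by-kind : ∀ {P : Set} x y → (x ≡ y → P) → (E x y → P) → (Co E x y → P) → P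
    by-kind x y same edge co with meets x y
    ... | zero , m = same m
    ... | suc zero , m = edge m
    ... | suc (suc zero) , m = co m

    -- Ruling out the nine canonical behaviours

    module Obstruction {xsᶜ xsᴱ xsᴺ xs : List ℕ}
      (¬const : ∀ f → M f → ¬ ConstantOn xsᶜ f)
      (¬cliqueᴱ : ∀ f → M f → ¬ CliqueOn E xsᴱ f)
      (¬cliqueᴺ : ∀ f → M f → ¬ CliqueOn (Co E) xsᴺ f) where

      -- A map exchanging edges and non-edges on `map σ xs` composes with `σ` to an isomorphism on
      -- `xs`.
      complementing : ∃ λ σ → IsoOn (Co E) E xs σ
      complementing = embed em (proj₁ rgᶜ) rg xs

      σ : ℕ → ℕ
      σ = proj₁ complementing

      σ-edge : ∀ {x y} → x ∈ xs → y ∈ xs → Co E x y → E (σ x) (σ y)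
      σ-edge x∈ y∈ = preserves (proj₂ complementing x∈ y∈)

      σ-nonedge : ∀ {x y} → x ∈ xs → y ∈ xs → E x y → Co E (σ x) (σ y)
      σ-nonedge {x} {y} x∈ y∈ e = by-kind (σ x) (σ y)
        (λ eq → ⊥-elim (proj₂ graph y (subst (λ z → E z y) (injective σ-iso eq) e)))
        (λ e′ → ⊥-elim (proj₂ (reflects σ-iso e′) e)) id
        where σ-iso = proj₂ complementing x∈ y∈

      path pathᶜ : List ℕ
      path = let x , y , z , _ = induced-path rg in x ∷ y ∷ z ∷ []
      pathᶜ = let x , y , z , _ = induced-path rgᶜ in x ∷ y ∷ z ∷ []

      A : List ℕ
      A = path ++ pathᶜ ++ xs ++ map σ xs ++ xsᶜ ++ xsᴱ ++ xsᴺ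

      ∈ᵖ : ∀ {x} → x ∈ path → x ∈ A
      ∈ᵖ = ∈-++⁺ˡ
      ∈ᵖᶜ : ∀ {x} → x ∈ pathᶜ → x ∈ A
      ∈ᵖᶜ = ∈-++⁺ʳ path ∘ ∈-++⁺ˡ
      ∈ˣ : ∀ {x} → x ∈ xs → x ∈ A
      ∈ˣ = ∈-++⁺ʳ path ∘ ∈-++⁺ʳ pathᶜ ∘ ∈-++⁺ˡ
      ∈σ : ∀ {x} → x ∈ xs → σ x ∈ A
      ∈σ = ∈-++⁺ʳ path ∘ ∈-++⁺ʳ pathᶜ ∘ ∈-++⁺ʳ xs ∘ ∈-++⁺ˡ ∘ ∈-map⁺ σ
      ∈ᶜ : ∀ {x} → x ∈ xsᶜ → x ∈ A
      ∈ᶜ = ∈-++⁺ʳ path ∘ ∈-++⁺ʳ pathᶜ ∘ ∈-++⁺ʳ xs ∘ ∈-++⁺ʳ (map σ xs) ∘ ∈-++⁺ˡ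
      ∈ᴱ : ∀ {x} → x ∈ xsᴱ → x ∈ A
      ∈ᴱ = ∈-++⁺ʳ path ∘ ∈-++⁺ʳ pathᶜ ∘ ∈-++⁺ʳ xs ∘ ∈-++⁺ʳ (map σ xs) ∘ ∈-++⁺ʳ xsᶜ ∘ ∈-++⁺ˡ
      ∈ᴺ : ∀ {x} → x ∈ xsᴺ → x ∈ A
      ∈ᴺ = ∈-++⁺ʳ path ∘ ∈-++⁺ʳ pathᶜ ∘ ∈-++⁺ʳ xs ∘ ∈-++⁺ʳ (map σ xs) ∘ ∈-++⁺ʳ xsᶜ ∘ ∈-++⁺ʳ xsᴱ

      invertible : ∀ {u : ℕ → ℕ} → (∀ {x y} → x ∈ xs → y ∈ xs → PairIso E E x y (u x) (u y)) → Invertible xs u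
      invertible iso = transport λ x∈ y∈ → PairIso-inverse (iso x∈ y∈)

      obstruction : ∀ k l f → M f → (∀ u → (∀ {x} → x ∈ xs → u x ∈ A) → ¬ Invertible xs (f ∘ u)) → ¬ SendsOn A k l f
      obstruction zero zero f mf dead (onE , onN) = ¬const f mf λ {x} {y} x∈ y∈ →
        by-kind x y (cong f) (onE (∈ᶜ x∈) (∈ᶜ y∈)) (onN (∈ᶜ x∈) (∈ᶜ y∈))
      -- Both edges of the path collapse, so its ends get the same image, yet as a non-edge they go
      -- to distinct vertices.
      obstruction zero (suc l) f mf dead (onE , onN) =
        let x , y , z , xy , yz , xz = induced-path rg
            x∈ = ∈ᵖ (here refl) ; y∈ = ∈ᵖ (there (here refl)) ; z∈ = ∈ᵖ (there (there (here refl)))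
        in Meets-irrefl l (subst (Meets (suc l) (f x)) (sym (trans (onE x∈ y∈ xy) (onE y∈ z∈ yz))) (onN x∈ z∈ xz))
      -- Dually, the ends of a path of the complement form an edge of `E`, being distinct and not
      -- related by `Co E`.
      obstruction (suc k) zero f mf dead (onE , onN) =
        let x , y , z , xy , yz , x≢z , ¬xz = induced-path rgᶜ
            x∈ = ∈ᵖᶜ (here refl) ; y∈ = ∈ᵖᶜ (there (here refl)) ; z∈ = ∈ᵖᶜ (there (there (here refl)))
        in Meets-irrefl k (subst (Meets (suc k) (f x)) (sym (trans (onN x∈ y∈ xy) (onN y∈ z∈ yz)))
             (onE x∈ z∈ (by-kind x z (⊥-elim ∘ x≢z) id (⊥-elim ∘ ¬xz))))
      obstruction (suc zero) (suc zero) f mf dead (onE , onN) = ¬cliqueᴱ f mf λ {x} {y} x∈ y∈ x≢y →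
        by-kind x y (⊥-elim ∘ x≢y) (onE (∈ᴱ x∈) (∈ᴱ y∈)) (onN (∈ᴱ x∈) (∈ᴱ y∈))
      obstruction (suc (suc zero)) (suc (suc zero)) f mf dead (onE , onN) = ¬cliqueᴺ f mf λ {x} {y} x∈ y∈ x≢y →
        by-kind x y (⊥-elim ∘ x≢y) (onE (∈ᴺ x∈) (∈ᴺ y∈)) (onN (∈ᴺ x∈) (∈ᴺ y∈))
      obstruction (suc zero) (suc (suc zero)) f mf dead (onE , onN) = dead id ∈ˣ (invertible λ x∈ y∈ →
        pair-iso {f} (onE (∈ˣ x∈) (∈ˣ y∈)) (onN (∈ˣ x∈) (∈ˣ y∈)))
      obstruction (suc (suc zero)) (suc zero) f mf dead (onE , onN) = dead σ ∈σ (invertible λ x∈ y∈ →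
        pair-iso {f ∘ σ} (onN (∈σ x∈) (∈σ y∈) ∘ σ-nonedge x∈ y∈) (onE (∈σ x∈) (∈σ y∈) ∘ σ-edge x∈ y∈))

    undo : (∃ λ xs → ∀ f → M f → ¬ ConstantOn xs f) → (∃ λ xs → ∀ f → M f → ¬ CliqueOn E xs f) →
           (∃ λ xs → ∀ f → M f → ¬ CliqueOn (Co E) xs f) → ∀ f → M f → ∀ xs → Invertible xs f
    undo (_ , ¬const) (_ , ¬cliqueᴱ) (_ , ¬cliqueᴺ) f mf xs with em {Invertible xs f}
    ... | yes inv = inv
    ... | no ¬inv = ⊥-elim (no-obstruction A obstruction)
      where
      open Obstruction {xs = xs} ¬const ¬cliqueᴱ ¬cliqueᴺ
      -- The canonical copy `φ` of `B` lies in a set `H` all of whose copies of `xs` are made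
      -- non-invertible by `g`. Replacing `φ` by a member `α` of `M` that agrees with it on `B`
      -- gives `g ∘ α` in `M`, canonical on `B` itself.
      no-obstruction : ∀ B → ¬ (∀ k l f → M f →
        (∀ u → (∀ {x} → x ∈ xs → u x ∈ B) → ¬ Invertible xs (f ∘ u)) → ¬ SendsOn B k l f)
      no-obstruction B excluded
        with H , canonical ← canonical-ramsey em rg 3 B
        with g , mg , dead ← avoid-into mf ¬inv H
        with φ , (into , iso) , (k , onE) , (l , onN) ← canonical (λ x y → kind (g x) (g y)) (λ x y → kind-sym (g x) (g y))
        with α , mα , α≡φ ← transport {f = id} {u = φ} iso
        = excluded k l (g ∘ α) (M-∘ mg mα)
            (λ u u∈ (h , mh , eq) → dead (φ ∘ u) (into ∘ u∈)
              (h , mh , λ x∈ → trans (cong (h ∘ g) (sym (α≡φ (u∈ x∈)))) (eq x∈)))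
            ( (λ x∈ y∈ e → subst₂ (Meets k) (via x∈) (via y∈) (kind-meets (onE x∈ y∈ e)))
            , (λ x∈ y∈ c → subst₂ (Meets l) (via x∈) (via y∈) (kind-meets (onN x∈ y∈ c))))
        where
        via : ∀ {x} → x ∈ B → g (φ x) ≡ g (α x)
        via x∈ = cong g (sym (α≡φ x∈))

    -- Turns the failure of approximation into one finite set that can be included in `A`.
    excluded-on : {P : List ℕ → (ℕ → ℕ) → Set} → ¬ (∀ xs → ∃ λ f → M f × P xs f) → ∃ λ xs → ∀ f → M f → ¬ P xs f
    excluded-on ¬all with xs , none ← ¬∀⇒∃¬ ¬all = xs , λ f mf p → none (f , mf , p)

theorem1 : ExcludedMiddle 0ℓ → ExcludedMiddle (lsuc 0ℓ) →
    (E : Rel₀) → IsRandomGraph E →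
    (M : MapSet 0ℓ) → LocallyClosedMonoid M →
    (∀ α → IsAutomorphism E α → M α) →
    (Σ (ℕ → ℕ) λ f → M f × IsConstant f)
    ⊎ (Σ (ℕ → ℕ) λ f → M f × IsEmbeddingE E f)
    ⊎ (Σ (ℕ → ℕ) λ f → M f × IsEmbeddingN E f)
    ⊎ ((∀ f → M f → Generated (λ g → M g × IsPermutation g) f)
    × (∀ f → Generated (λ g → M g × IsPermutation g) f → M f))
theorem1 em _ E rg M lcm aut = split em em em
  where
  open Monoid em rg lcm aut
  split : Dec (∀ xs → ∃ λ f → M f × ConstantOn xs f) → Dec (∀ xs → ∃ λ f → M f × CliqueOn E xs f) →
          Dec (∀ xs → ∃ λ f → M f × CliqueOn (Co E) xs f) → _
  split (yes const) _ _ = inj₁ (_ , constant∈M const , 0 , λ _ → refl)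
  split (no _) (yes cliques) _ = inj₂ (inj₁ (_ , clique∈M rg id cliques , clique-injective rg , λ _ _ → clique-adjacent rg))
  split (no _) (no _) (yes cliques) = inj₂ (inj₂ (inj₁
    (clique rgᶜ , clique∈M rgᶜ (Co-iso em graph) cliques , clique-injective rgᶜ , independent)))
    where
    independent : ∀ x y → ¬ E (clique rgᶜ x) (clique rgᶜ y)
    independent x y e with x ≟ y
    ... | yes refl = proj₂ graph _ e
    ... | no x≢y = proj₂ (clique-adjacent rgᶜ x≢y) e
  split (no ¬const) (no ¬cliques) (no ¬cliquesᶜ) = inj₂ (inj₂ (inj₂
    ( Symmetric.generated (undo (excluded-on {ConstantOn} ¬const) (excluded-on {CliqueOn E} ¬cliques) (excluded-on {CliqueOn (Co E)} ¬cliquesᶜ))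
    -- `M` is itself one of the locally closed monoids over which `Generated` ranges.
    , λ f gen → gen M lcm λ _ → proj₁)))
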